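{- Let $d\geq 1$ be an integer and let $Q$ be a finite (left) quasifield with $q$ elements whose kernel is $K$. If $A\subset Q$ and $|A| > q^{\frac12 + \frac1d}(|K|-1)^{ -1/(2d)}$, then \[ Q\setminus\{0\} \subset \underbrace{A\cdot A + \cdots + A\cdot A}_{d\ \text{terms}}, \] i.e., every nonzero element of $Q$ can be written as $a_1\cdot a_1' + \cdots + a_d\cdot a_d'$ with all $a_i,a_i'\in A$.
   Context: A (left) quasifield is a set $Q$ with two binary operations $+$ and $\cdot$ such that $(Q,+)$ is a group with identity $0$; $(Q\setminus\{0\},\cdot)$ is a loop (for all $a,b$ the equations $a\cdot x=b$ and $y\cdot a=b$ have unique solutions, and there is an identity $1$); $a\cdot(b+c)=a\cdot b+a\cdot c$ for all $a,b,c$; $0\cdot x=0$ for all $x$; and for $a\neq b$ the equation $a\cdot x=b\cdot x+c$ has exactly one solution $x$. The kernel $K$ of $Q$ is the set of all $k\in Q$ such that $(x+y)\cdot k = x\cdot k + y\cdot k$ and $(x\cdot y)\cdot k = x\cdot(y\cdot k)$ for all $x,y\in Q$. -}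

module Defs where

open import Data.Nat using (ℕ; zero; suc)
open import Data.Fin using (Fin; zero; suc)
open import Data.Fin.Subset using (Subset; _∈_)
open import Data.Product using (Σ; _×_; _,_)
open import Relation.Binary.PropositionalEquality using (_≡_)
open import Relation.Nullary using (¬_)

∃!′ : {A : Set} → (A → Set) → Set
∃!′ {A} P = Σ A (λ x → P x × (∀ y → P y → y ≡ x))

record IsQuasifield (q : ℕ) (_+_ _·_ : Fin q → Fin q → Fin q)
                    (-_ : Fin q → Fin q) (𝟎 𝟏 : Fin q) : Set where
  field
    +-assoc    : ∀ x y z → (x + y) + z ≡ x + (y + z)
    +-identityˡ : ∀ x → 𝟎 + x ≡ x
    +-identityʳ : ∀ x → x + 𝟎 ≡ x
    +-inverseˡ : ∀ x → (- x) + x ≡ 𝟎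
    +-inverseʳ : ∀ x → x + (- x) ≡ 𝟎
    𝟏≢𝟎        : ¬ (𝟏 ≡ 𝟎)
    ·-closed   : ∀ a b → ¬ (a ≡ 𝟎) → ¬ (b ≡ 𝟎) → ¬ ((a · b) ≡ 𝟎)
    ·-identityˡ : ∀ x → ¬ (x ≡ 𝟎) → 𝟏 · x ≡ x
    ·-identityʳ : ∀ x → ¬ (x ≡ 𝟎) → x · 𝟏 ≡ x
    ·-ldiv     : ∀ a b → ¬ (a ≡ 𝟎) → ¬ (b ≡ 𝟎) →
                 ∃!′ (λ x → ¬ (x ≡ 𝟎) × (a · x ≡ b))
    ·-rdiv     : ∀ a b → ¬ (a ≡ 𝟎) → ¬ (b ≡ 𝟎) →
                 ∃!′ (λ y → ¬ (y ≡ 𝟎) × (y · a ≡ b))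
    distribˡ   : ∀ a b c → a · (b + c) ≡ (a · b) + (a · c)
    zeroˡ      : ∀ x → 𝟎 · x ≡ 𝟎
    unique-sol : ∀ a b c → ¬ (a ≡ b) → ∃!′ (λ x → a · x ≡ (b · x) + c)

InKernel : ∀ {q} (_+_ _·_ : Fin q → Fin q → Fin q) → Fin q → Set
InKernel _+_ _·_ k =
  (∀ x y → (x + y) · k ≡ (x · k) + (y · k)) ×
  (∀ x y → (x · y) · k ≡ x · (y · k))

sumF : ∀ {q} (_+_ : Fin q → Fin q → Fin q) (𝟎 : Fin q) {d : ℕ} → (Fin d → Fin q) → Fin q
sumF _+_ 𝟎 {zero}  f = 𝟎
sumF _+_ 𝟎 {suc d} f = f zero + sumF _+_ 𝟎 (λ i → f (suc i))

InSumProd : ∀ {q} (_+_ _·_ : Fin q → Fin q → Fin q) (𝟎 : Fin q)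
            (d : ℕ) (A : Subset q) → Fin q → Set
InSumProd {q} _+_ _·_ 𝟎 d A x =
  Σ (Fin d → Fin q) λ a → Σ (Fin d → Fin q) λ a′ →
    (∀ i → a i ∈ A) × (∀ i → a′ i ∈ A) ×
    (x ≡ sumF _+_ 𝟎 (λ i → a i · a′ i))

{-# OPTIONS --safe #-}
-- For y ∈ Q^d and z ∈ Q let n(y,z) be the number of a ∈ A^d with a·y = z, and let u = |A|^d.
-- Two distinct a, b satisfy a·y = b·y for at most q^(d-1) vectors y, because in a coordinate
-- where they differ the equation a_i y_i = b_i y_i + c has at most one solution.  This bounds
-- Σ n², and the second moment of n around its mean u/q satisfies Σ (q n(y,z) − u)² ≤ u q^(d+2).
-- If x is not of the form a·a′ with a, a′ ∈ A^d, then neither is x k of the form a·(a′ k) for k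
-- in the kernel, k ≠ 0; hence n(a′ k, x k) = 0, and these u (|K| − 1) distinct pairs contribute
-- u² each.  Thus u² (|K| − 1) ≤ q^(d+2), against the hypothesis on |A|.
module Submission where

open import Defs
open import Data.Bool using (true; false; if_then_else_)
open import Data.Nat using (ℕ; zero; suc; z≤n; ∣_-_∣; _*_; _^_; _<_; _≤_; _∸_; _+_)
open import Data.Nat.Properties hiding (_≟_)
open import Data.Nat.ListAction using (sum)
open import Data.Nat.ListAction.Properties using (sum-++)
open import Data.Nat.Tactic.RingSolver using (solve-∀)
open import Data.Fin using (Fin; zero; suc; _≟_)
open import Data.Fin.Properties using (any?)
open import Data.Fin.Subset using (Subset; _∈_; ∣_∣)
open import Data.Fin.Subset.Properties using (_∈?_)
open import Data.List using (List; []; _∷_; _++_; map; length; allFin; tabulate; cartesianProductWith; cartesianProduct)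
open import Data.List.Properties using (map-++; map-∘; map-cong; map-tabulate; length-tabulate; tabulate-cong)
open import Data.List.Membership.Propositional using () renaming (_∈_ to _∈ₗ_)
open import Data.List.Membership.Propositional.Properties using (∈-allFin; ∈-cartesianProductWith⁺)
open import Data.List.Relation.Unary.All as List using ([]; _∷_)
open import Data.List.Relation.Unary.Any using (here; there)
open import Data.List.Relation.Unary.Unique.Propositional using (Unique; []; _∷_)
open import Data.List.Relation.Unary.Unique.Propositional.Properties using (allFin⁺; cartesianProductWith⁺)
open import Data.Product using (∃; _×_; _,_; proj₁; proj₂)
open import Data.Vec using (Vec; []; _∷_; lookup)
import Data.Vec as Vec
open import Data.Vec.Properties using (∷-injective; ≡-dec)
open import Data.Vec.Relation.Unary.All using (All; []; _∷_; all?)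
open import Function using (_∘_; id)
open import Relation.Binary.Definitions using (DecidableEquality)
open import Relation.Binary.PropositionalEquality using (_≡_; _≢_; refl; sym; trans; cong; cong₂; subst; module ≡-Reasoning)
open import Relation.Nullary using (¬_; Dec; yes; no; does; contradiction)
open import Relation.Nullary.Decidable using (map′; _×-dec_)

private
  variable
    X Y Z : Set

-- Finite sums

∑ : List X → (X → ℕ) → ℕ
∑ xs f = sum (map f xs)

∑-cong : ∀ (xs : List X) {f g : X → ℕ} → (∀ x → f x ≡ g x) → ∑ xs f ≡ ∑ xs g
∑-cong xs f≡g = cong sum (map-cong f≡g xs)

∑-mono : ∀ (xs : List X) {f g : X → ℕ} → (∀ x → f x ≤ g x) → ∑ xs f ≤ ∑ xs g
∑-mono []       f≤g = z≤n
∑-mono (x ∷ xs) f≤g = +-mono-≤ (f≤g x) (∑-mono xs f≤g)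

∑-const : ∀ (xs : List X) c → ∑ xs (λ _ → c) ≡ length xs * c
∑-const []       c = refl
∑-const (x ∷ xs) c = cong (c +_) (∑-const xs c)

∑-distrib-+ : ∀ (xs : List X) (f g : X → ℕ) → ∑ xs (λ x → f x + g x) ≡ ∑ xs f + ∑ xs g
∑-distrib-+ []       f g = refl
∑-distrib-+ (x ∷ xs) f g = trans (cong (f x + g x +_) (∑-distrib-+ xs f g)) (interchange (f x) (g x) _ _)
  where
  interchange : ∀ a b c d → a + b + (c + d) ≡ a + c + (b + d)
  interchange = solve-∀

∑-*ˡ : ∀ (xs : List X) c (f : X → ℕ) → ∑ xs (λ x → c * f x) ≡ c * ∑ xs f
∑-*ˡ []       c f = sym (*-zeroʳ c)
∑-*ˡ (x ∷ xs) c f = trans (cong (c * f x +_) (∑-*ˡ xs c f)) (sym (*-distribˡ-+ c (f x) _))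

∑-*ʳ : ∀ (xs : List X) (f : X → ℕ) c → ∑ xs (λ x → f x * c) ≡ ∑ xs f * c
∑-*ʳ xs f c = trans (∑-cong xs (λ x → *-comm (f x) c)) (trans (∑-*ˡ xs c f) (*-comm c _))

∑-swap : ∀ (xs : List X) (ys : List Y) (f : X → Y → ℕ) →
         ∑ xs (λ x → ∑ ys (f x)) ≡ ∑ ys (λ y → ∑ xs (λ x → f x y))
∑-swap []       ys f = sym (trans (∑-const ys 0) (*-zeroʳ (length ys)))
∑-swap (x ∷ xs) ys f = trans (cong (∑ ys (f x) +_) (∑-swap xs ys f))
                             (sym (∑-distrib-+ ys (f x) (λ y → ∑ xs (λ x → f x y))))

∑-cartesianProductWith : ∀ (h : X → Y → Z) xs ys (f : Z → ℕ) →
  ∑ (cartesianProductWith h xs ys) f ≡ ∑ xs (λ x → ∑ ys (λ y → f (h x y)))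
∑-cartesianProductWith h []       ys f = refl
∑-cartesianProductWith h (x ∷ xs) ys f = begin
  sum (map f (map (h x) ys ++ zs))        ≡⟨ cong sum (map-++ f (map (h x) ys) zs) ⟩
  sum (map f (map (h x) ys) ++ map f zs) ≡⟨ sum-++ (map f (map (h x) ys)) _ ⟩
  sum (map f (map (h x) ys)) + ∑ zs f        ≡⟨ cong₂ _+_ (cong sum (sym (map-∘ ys))) (∑-cartesianProductWith h xs ys f) ⟩
  ∑ ys (λ y → f (h x y)) + ∑ xs (λ x → ∑ ys (λ y → f (h x y))) ∎
  where
  open ≡-Reasoning
  zs = cartesianProductWith h xs ys

χ : Dec X → ℕ
χ p = if does p then 1 else 0

χ-mono : (X → Y) → (p : Dec X) (r : Dec Y) → χ p ≤ χ r
χ-mono f (yes x) (yes y) = ≤-refl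
χ-mono f (yes x) (no ¬y) = contradiction (f x) ¬y
χ-mono f (no ¬x) r       = z≤n

χ≤1 : (p : Dec X) → χ p ≤ 1
χ≤1 (yes _) = ≤-refl
χ≤1 (no _)  = z≤n

module _ {P : X → Set} (P? : ∀ x → Dec (P x)) where

  ∑-none : ∀ {xs} → List.All (¬_ ∘ P) xs → ∑ xs (χ ∘ P?) ≡ 0
  ∑-none []                     = refl
  ∑-none {x ∷ _} (¬p ∷ ¬ps) with P? x
  ... | yes p = contradiction p ¬p
  ... | no _  = ∑-none ¬ps

  -- Turns uniqueness of a solution into a count: once an entry satisfies `P`, all later entries
  -- differ from it and so fail `P`.
  ∑-atMostOne : ∀ {xs} → Unique xs → (∀ {x y} → P x → P y → x ≡ y) → ∑ xs (χ ∘ P?) ≤ 1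
  ∑-atMostOne []              inj = z≤n
  ∑-atMostOne {x ∷ _} (x≢ ∷ un) inj with P? x
  ... | yes p = ≤-reflexive (cong suc (∑-none (List.map (λ x≢y py → x≢y (inj p py)) x≢)))
  ... | no _  = ∑-atMostOne un inj

module _ (_≟′_ : DecidableEquality X) where

  ∑-δ-none : ∀ {c xs} → List.All (c ≢_) xs → ∀ (f : X → ℕ) → ∑ xs (λ x → χ (c ≟′ x) * f x) ≡ 0
  ∑-δ-none []               f = refl
  ∑-δ-none {c} {x ∷ _} (c≢x ∷ c≢) f with c ≟′ x
  ... | yes c≡x = contradiction c≡x c≢x
  ... | no _    = ∑-δ-none c≢ f

  ∑-δ : ∀ {c xs} → Unique xs → c ∈ₗ xs → ∀ (f : X → ℕ) → ∑ xs (λ x → χ (c ≟′ x) * f x) ≡ f c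
  ∑-δ {c} {x ∷ xs} (x≢ ∷ un) c∈ f with c ≟′ x | c∈
  ... | yes refl | _          = trans (cong₂ _+_ (+-identityʳ (f c)) (∑-δ-none x≢ f)) (+-identityʳ (f c))
  ... | no c≢x   | here c≡x   = contradiction c≡x c≢x
  ... | no _     | there c∈xs = ∑-δ un c∈xs f

  -- Inserting a delta and swapping the sums weights each `f j` by the size of the fibre of `π` over
  -- `j`, which is at most 1. It serves below for the two reindexings by a multiplication, y ↦ y k
  -- on vectors and k ↦ x k on `Fin q`.
  ∑-injective : ∀ {xs : List X} → Unique xs → (∀ x → x ∈ₗ xs) →
    (π : X → X) → (∀ {x y} → π x ≡ π y → x ≡ y) → (f : X → ℕ) →
    ∑ xs (f ∘ π) ≤ ∑ xs f
  ∑-injective {xs} un full π inj f = begin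
    ∑ xs (f ∘ π)                                   ≡⟨ ∑-cong xs (λ i → ∑-δ un (full (π i)) f) ⟨
    ∑ xs (λ i → ∑ xs (λ j → χ (π i ≟′ j) * f j))  ≡⟨ ∑-swap xs xs _ ⟩
    ∑ xs (λ j → ∑ xs (λ i → χ (π i ≟′ j) * f j))  ≡⟨ ∑-cong xs (λ j → ∑-*ʳ xs _ (f j)) ⟩
    ∑ xs (λ j → ∑ xs (λ i → χ (π i ≟′ j)) * f j)  ≤⟨ ∑-mono xs (λ j → *-monoˡ-≤ (f j)
      (∑-atMostOne (λ i → π i ≟′ j) un (λ πi≡j πi′≡j → inj (trans πi≡j (sym πi′≡j))))) ⟩
    ∑ xs (λ j → 1 * f j)                           ≡⟨ ∑-cong xs (λ j → *-identityˡ (f j)) ⟩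
    ∑ xs f                                         ∎
    where open ≤-Reasoning

∑-χ-∈ : ∀ {n} (p : Subset n) → ∑ (allFin n) (λ x → χ (x ∈? p)) ≡ ∣ p ∣
∑-χ-∈ {n} p = trans (cong sum (map-tabulate id (λ x → χ (x ∈? p)))) (go p)
  where
  shift : ∀ {n} b (p : Subset n) i → χ (suc i ∈? (b ∷ p)) ≡ χ (i ∈? p)
  shift b p i with i ∈? p
  ... | yes _ = refl
  ... | no _  = refl
  rest : ∀ {n} b (p : Subset n) → sum (tabulate (λ i → χ (suc i ∈? (b ∷ p)))) ≡ sum (tabulate (λ i → χ (i ∈? p)))
  rest b p = cong sum (tabulate-cong (shift b p))
  go : ∀ {n} (p : Subset n) → sum (tabulate (λ x → χ (x ∈? p))) ≡ ∣ p ∣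
  go []          = refl
  go (true ∷ p)  = cong suc (trans (rest true p) (go p))
  go (false ∷ p) = trans (rest false p) (go p)

-- The expansion of (m - n)² with the cross term moved to the left, so that the second moment can be
-- computed in ℕ.
∣m-n∣²+2mn≡m²+n² : ∀ m n → ∣ m - n ∣ * ∣ m - n ∣ + 2 * (m * n) ≡ m * m + n * n
∣m-n∣²+2mn≡m²+n² zero    n       = +-identityʳ (n * n)
∣m-n∣²+2mn≡m²+n² (suc m) zero    = cong (suc m * suc m +_) (cong (2 *_) (*-zeroʳ m))
∣m-n∣²+2mn≡m²+n² (suc m) (suc n) =
  trans (lhs ∣ m - n ∣ m n)
    (trans (cong (_+ (2 * m + 2 * n + 2)) (∣m-n∣²+2mn≡m²+n² m n)) (rhs m n))
  where
  lhs : ∀ e m n → e * e + 2 * (suc m * suc n) ≡ e * e + 2 * (m * n) + (2 * m + 2 * n + 2)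
  lhs = solve-∀
  rhs : ∀ m n → m * m + n * n + (2 * m + 2 * n + 2) ≡ suc m * suc m + suc n * suc n
  rhs = solve-∀

-- Vectors over Fin q

vecs : ∀ q d → List (Vec (Fin q) d)
vecs q zero    = [] ∷ []
vecs q (suc d) = cartesianProductWith _∷_ (allFin q) (vecs q d)

vecs-unique : ∀ q d → Unique (vecs q d)
vecs-unique q zero    = [] ∷ []
vecs-unique q (suc d) = cartesianProductWith⁺ _∷_ ∷-injective (allFin⁺ q) (vecs-unique q d)

∈-vecs : ∀ {q d} (v : Vec (Fin q) d) → v ∈ₗ vecs q d
∈-vecs []      = here refl
∈-vecs (x ∷ v) = ∈-cartesianProductWith⁺ _∷_ (∈-allFin x) (∈-vecs v)

∑-allFin-const : ∀ q c → ∑ (allFin q) (λ _ → c) ≡ q * c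
∑-allFin-const q c = trans (∑-const (allFin q) c) (cong (_* c) (length-tabulate {n = q} id))

∑-vecs-const : ∀ q d c → ∑ (vecs q d) (λ _ → c) ≡ q ^ d * c
∑-vecs-const q zero    c = refl
∑-vecs-const q (suc d) c = begin
  ∑ (vecs q (suc d)) (λ _ → c)                   ≡⟨ ∑-cartesianProductWith _∷_ (allFin q) (vecs q d) _ ⟩
  ∑ (allFin q) (λ _ → ∑ (vecs q d) (λ _ → c))    ≡⟨ ∑-allFin-const q _ ⟩
  q * ∑ (vecs q d) (λ _ → c)                     ≡⟨ cong (q *_) (∑-vecs-const q d c) ⟩
  q * (q ^ d * c)                                ≡⟨ *-assoc q (q ^ d) c ⟨
  q ^ suc d * c                                  ∎
  where open ≡-Reasoning

-- Makes the existence of a representation decidable, which lets the theorem be proved by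
-- contradiction constructively.
anyVec? : ∀ {q d} {P : Vec (Fin q) d → Set} → (∀ v → Dec (P v)) → Dec (∃ P)
anyVec? {d = zero}  P? = map′ ([] ,_) (λ { ([] , p) → p }) (P? [])
anyVec? {d = suc d} P? = map′ (λ { (x , v , p) → x ∷ v , p }) (λ { (x ∷ v , p) → x , v , p })
                              (any? (λ x → anyVec? (λ v → P? (x ∷ v))))

lookup⁺ : ∀ {q d} {A : Subset q} {v : Vec (Fin q) d} → All (_∈ A) v → ∀ i → lookup v i ∈ A
lookup⁺ (x∈A ∷ _)  zero    = x∈A
lookup⁺ (_ ∷ v∈A)  (suc i) = lookup⁺ v∈A i

map-injective : ∀ {d} {f : X → Y} → (∀ {x y} → f x ≡ f y → x ≡ y) →
                {v w : Vec X d} → Vec.map f v ≡ Vec.map f w → v ≡ w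
map-injective inj {[]}    {[]}    eq = refl
map-injective inj {_ ∷ _} {_ ∷ _} eq =
  let x≡y , v≡w = ∷-injective eq in cong₂ _∷_ (inj x≡y) (map-injective inj v≡w)

χ-all : ∀ {q d} → Subset q → Vec (Fin q) d → ℕ
χ-all A v = χ (all? (_∈? A) v)

∑-χ-all : ∀ {q} (A : Subset q) d → ∑ (vecs q d) (χ-all A) ≡ ∣ A ∣ ^ d
∑-χ-all {q} A zero    = refl
∑-χ-all {q} A (suc d) = begin
  ∑ (vecs q (suc d)) (χ-all A)                                  ≡⟨ ∑-cartesianProductWith _∷_ (allFin q) (vecs q d) _ ⟩
  ∑ (allFin q) (λ x → ∑ (vecs q d) (λ v → χ-all A (x ∷ v)))     ≡⟨ ∑-cong (allFin q) (λ x → trans (∑-cong (vecs q d) (split x)) (∑-*ˡ (vecs q d) (χ (x ∈? A)) (χ-all A))) ⟩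
  ∑ (allFin q) (λ x → χ (x ∈? A) * ∑ (vecs q d) (χ-all A))      ≡⟨ ∑-*ʳ (allFin q) _ _ ⟩
  ∑ (allFin q) (λ x → χ (x ∈? A)) * ∑ (vecs q d) (χ-all A)      ≡⟨ cong₂ _*_ (∑-χ-∈ A) (∑-χ-all A d) ⟩
  ∣ A ∣ ^ suc d                                                  ∎
  where
  open ≡-Reasoning
  split : ∀ x (v : Vec (Fin q) d) → χ-all A (x ∷ v) ≡ χ (x ∈? A) * χ-all A v
  split x v with x ∈? A | all? (_∈? A) v
  ... | yes _ | yes _ = refl
  ... | yes _ | no _  = refl
  ... | no _  | _     = refl

-- Quasifields

module _ {q : ℕ} {_⊕_ _·_ : Fin q → Fin q → Fin q} {⊖_ : Fin q → Fin q} {𝟎 𝟏 : Fin q}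
         (Q : IsQuasifield q _⊕_ _·_ ⊖_ 𝟎 𝟏) where

  private module Q = IsQuasifield Q

  ⊕-cancelˡ : ∀ a {b c} → a ⊕ b ≡ a ⊕ c → b ≡ c
  ⊕-cancelˡ a {b} {c} eq = trans (sym (undo b)) (trans (cong ((⊖ a) ⊕_) eq) (undo c))
    where
    undo : ∀ b → (⊖ a) ⊕ (a ⊕ b) ≡ b
    undo b = trans (sym (Q.+-assoc (⊖ a) a b)) (trans (cong (_⊕ b) (Q.+-inverseˡ a)) (Q.+-identityˡ b))

  -- Adding -s on the right gives a x = b x + (t - s), to which the axiom `unique-sol` applies. The
  -- order of the summands is kept because addition is not assumed commutative.
  ax+s≡bx+t-unique : ∀ {a b} → a ≢ b → ∀ s t {x y} →
    (a · x) ⊕ s ≡ (b · x) ⊕ t → (a · y) ⊕ s ≡ (b · y) ⊕ t → x ≡ y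
  ax+s≡bx+t-unique {a} {b} a≢b s t {x} {y} ex ey with Q.unique-sol a b (t ⊕ (⊖ s)) a≢b
  ... | _ , _ , unique = trans (unique x (move ex)) (sym (unique y (move ey)))
    where
    open ≡-Reasoning
    move : ∀ {l r} → l ⊕ s ≡ r ⊕ t → l ≡ r ⊕ (t ⊕ (⊖ s))
    move {l} {r} eq = begin
      l                    ≡⟨ Q.+-identityʳ l ⟨
      l ⊕ 𝟎                ≡⟨ cong (l ⊕_) (Q.+-inverseʳ s) ⟨
      l ⊕ (s ⊕ (⊖ s))      ≡⟨ Q.+-assoc l s (⊖ s) ⟨
      (l ⊕ s) ⊕ (⊖ s)      ≡⟨ cong (_⊕ (⊖ s)) eq ⟩
      (r ⊕ t) ⊕ (⊖ s)      ≡⟨ Q.+-assoc r t (⊖ s) ⟩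
      r ⊕ (t ⊕ (⊖ s))      ∎

  -- Left distributivity gives a 0 = a 0 + a 0, and one summand cancels.
  ·-zeroʳ : ∀ a → a · 𝟎 ≡ 𝟎
  ·-zeroʳ a = sym (⊕-cancelˡ (a · 𝟎) (trans (Q.+-identityʳ _)
    (trans (cong (a ·_) (sym (Q.+-identityˡ 𝟎))) (Q.distribˡ a 𝟎 𝟎))))

  -- Both elements solve a z = 0 z + a y in the unknown z, and this equation has only one solution
  -- since a ≠ 0.
  ·-cancelˡ : ∀ {a} → a ≢ 𝟎 → ∀ {x y} → a · x ≡ a · y → x ≡ y
  ·-cancelˡ {a} a≢𝟎 {x} {y} eq = ax+s≡bx+t-unique a≢𝟎 𝟎 (a · y) (lemma x eq) (lemma y refl)
    where
    lemma : ∀ x → a · x ≡ a · y → (a · x) ⊕ 𝟎 ≡ (𝟎 · x) ⊕ (a · y)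
    lemma x eq = trans (Q.+-identityʳ _) (trans eq (trans (sym (Q.+-identityˡ _))
      (cong (_⊕ (a · y)) (sym (Q.zeroˡ x)))))

  -- If a ≠ b, then a z = b z has only one solution z; as 0 is one, k would be 0.
  ·-cancelʳ : ∀ {k} → k ≢ 𝟎 → ∀ {a b} → a · k ≡ b · k → a ≡ b
  ·-cancelʳ {k} k≢𝟎 {a} {b} eq with a ≟ b
  ... | yes a≡b = a≡b
  ... | no a≢b  = contradiction
    (ax+s≡bx+t-unique a≢b 𝟎 𝟎 (cong (_⊕ 𝟎) eq)
      (cong (_⊕ 𝟎) (trans (·-zeroʳ a) (sym (·-zeroʳ b)))))
    k≢𝟎

  dot : ∀ {d} → Vec (Fin q) d → Vec (Fin q) d → Fin q
  dot []      []      = 𝟎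
  dot (a ∷ v) (b ∷ w) = (a · b) ⊕ dot v w

  dot≡sumF : ∀ {d} (v w : Vec (Fin q) d) → dot v w ≡ sumF _⊕_ 𝟎 (λ i → lookup v i · lookup w i)
  dot≡sumF []      []      = refl
  dot≡sumF (a ∷ v) (b ∷ w) = cong ((a · b) ⊕_) (dot≡sumF v w)

  -- This is where the kernel enters: associativity takes `k` out of each product, and right
  -- distributivity takes it out of the sum.
  dot-kernel : ∀ {k} → InKernel _⊕_ _·_ k → ∀ {d} (v w : Vec (Fin q) d) →
               dot v (Vec.map (_· k) w) ≡ dot v w · k
  dot-kernel {k} _               []      []      = sym (Q.zeroˡ k)
  dot-kernel {k} inK@(dist , assoc) (a ∷ v) (b ∷ w) =
    trans (cong₂ _⊕_ (sym (assoc a b)) (dot-kernel inK v w)) (sym (dist _ _))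

  -- Vectors on which two dot products agree

  collisions : ∀ {d} → Vec (Fin q) d → Vec (Fin q) d → ℕ
  collisions {d} a b = ∑ (vecs q d) (λ y → χ (dot b y ≟ dot a y))

  -- The bound q^(d-1), multiplied by `q` to avoid the predecessor of `d`. Induction on `d` reaches
  -- a coordinate where the vectors differ; that coordinate of y is determined by the coordinates
  -- after it.
  collisions-≢ : ∀ {d} (a b : Vec (Fin q) d) → a ≢ b → q * collisions a b ≤ q ^ d
  collisions-≢ {zero}  []      []      a≢b = contradiction refl a≢b
  collisions-≢ {suc d} (a ∷ v) (b ∷ w) a≢b = *-monoʳ-≤ q (≤-trans
      (≤-reflexive (∑-cartesianProductWith _∷_ (allFin q) (vecs q d) _)) bound)
    where
    open ≤-Reasoning
    hit : Fin q → Vec (Fin q) d → ℕ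
    hit x y = χ (((b · x) ⊕ dot w y) ≟ ((a · x) ⊕ dot v y))
    bound : ∑ (allFin q) (λ x → ∑ (vecs q d) (hit x)) ≤ q ^ d
    bound with b ≟ a
    -- Equal heads: the first terms cancel whatever `x` is, so each of the `q` choices of `x`
    -- contributes at most the collisions of the tails, which differ.
    ... | yes refl = begin
      ∑ (allFin q) (λ x → ∑ (vecs q d) (hit x))
        ≤⟨ ∑-mono (allFin q) (λ x → ∑-mono (vecs q d) (λ y → χ-mono (⊕-cancelˡ (b · x)) (_ ≟ _) (_ ≟ _))) ⟩
      ∑ (allFin q) (λ _ → collisions v w)
        ≡⟨ ∑-allFin-const q _ ⟩
      q * collisions v w
        ≤⟨ collisions-≢ v w (λ v≡w → a≢b (cong (b ∷_) v≡w)) ⟩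
      q ^ d ∎
    -- Different heads: each tail `y` allows at most one `x`, so the sum over `x` is done first.
    ... | no b≢a = begin
      ∑ (allFin q) (λ x → ∑ (vecs q d) (hit x))
        ≡⟨ ∑-swap (allFin q) (vecs q d) hit ⟩
      ∑ (vecs q d) (λ y → ∑ (allFin q) (λ x → hit x y))
        ≤⟨ ∑-mono (vecs q d) (λ y → ∑-atMostOne (λ x → _ ≟ _) (allFin⁺ q)
             (ax+s≡bx+t-unique b≢a (dot w y) (dot v y))) ⟩
      ∑ (vecs q d) (λ _ → 1)
        ≡⟨ ∑-vecs-const q d 1 ⟩
      q ^ d * 1
        ≡⟨ *-identityʳ (q ^ d) ⟩
      q ^ d ∎

  _≟ᵥ_ : ∀ {d} → DecidableEquality (Vec (Fin q) d)
  _≟ᵥ_ = ≡-dec _≟_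

  -- Encoding the diagonal case as a delta term gives one bound that can be summed over all `b`.
  collisions-≤ : ∀ {d} (a b : Vec (Fin q) d) → q * collisions a b ≤ q ^ d + χ (a ≟ᵥ b) * q ^ suc d
  collisions-≤ {d} a b with a ≟ᵥ b
  ... | no a≢b = m≤n⇒m≤n+o _ (collisions-≢ a b a≢b)
  ... | yes _  = m≤n⇒m≤o+n (q ^ d) (begin
    q * collisions a b               ≤⟨ *-monoʳ-≤ q (∑-mono (vecs q d) (λ y → χ≤1 (dot b y ≟ dot a y))) ⟩
    q * ∑ (vecs q d) (λ _ → 1)       ≡⟨ cong (q *_) (trans (∑-vecs-const q d 1) (*-identityʳ _)) ⟩
    q * q ^ d                        ≡⟨ *-identityˡ (q ^ suc d) ⟨
    1 * q ^ suc d                    ∎)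
    where open ≤-Reasoning

  -- The second moment of the number of representations

  module _ (A : Subset q) (d : ℕ) where

    private
      V : List (Vec (Fin q) d)
      V = vecs q d

      F : List (Fin q)
      F = allFin q

      pairs : List (Vec (Fin q) d × Fin q)
      pairs = cartesianProduct V F

      α : Vec (Fin q) d → ℕ
      α = χ-all A

      u : ℕ
      u = ∑ V α

      ∑-pairs : ∀ f → ∑ pairs f ≡ ∑ V (λ y → ∑ F (λ z → f (y , z)))
      ∑-pairs = ∑-cartesianProductWith _,_ V F

    -- The n(y, z) of the overview; membership in A^d is carried by the 0-1 weight `α`.
    repr : Vec (Fin q) d → Fin q → ℕ
    repr y z = ∑ V (λ a → α a * χ (dot a y ≟ z))

    -- The deviation from the mean u/q is scaled by `q` to stay integral. The absolute difference is
    -- harmless because it is squared.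
    dev² : Vec (Fin q) d → Fin q → ℕ
    dev² y z = ∣ q * repr y z - u ∣ * ∣ q * repr y z - u ∣

    -- Each `a` is counted in n(y, z) for exactly one z, namely a·y. Taking f = 1 yields the first
    -- moment and f = n(y, ·) the second.
    ∑-repr-* : ∀ y (f : Fin q → ℕ) → ∑ F (λ z → repr y z * f z) ≡ ∑ V (λ a → α a * f (dot a y))
    ∑-repr-* y f = begin
      ∑ F (λ z → repr y z * f z)
        ≡⟨ ∑-cong F (λ z → ∑-*ʳ V _ (f z)) ⟨
      ∑ F (λ z → ∑ V (λ a → α a * χ (dot a y ≟ z) * f z))
        ≡⟨ ∑-swap F V _ ⟩
      ∑ V (λ a → ∑ F (λ z → α a * χ (dot a y ≟ z) * f z))
        ≡⟨ ∑-cong V (λ a → trans (∑-cong F (λ z → *-assoc (α a) _ (f z))) (∑-*ˡ F (α a) _)) ⟩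
      ∑ V (λ a → α a * ∑ F (λ z → χ (dot a y ≟ z) * f z))
        ≡⟨ ∑-cong V (λ a → cong (α a *_) (∑-δ _≟_ (allFin⁺ q) (∈-allFin (dot a y)) f)) ⟩
      ∑ V (λ a → α a * f (dot a y)) ∎
      where open ≡-Reasoning

    ∑-repr : ∑ pairs (λ (y , z) → repr y z) ≡ q ^ d * u
    ∑-repr = begin
      ∑ pairs (λ (y , z) → repr y z)            ≡⟨ ∑-pairs _ ⟩
      ∑ V (λ y → ∑ F (repr y))                  ≡⟨ ∑-cong V (λ y → ∑-cong F (λ z → *-identityʳ (repr y z))) ⟨
      ∑ V (λ y → ∑ F (λ z → repr y z * 1))      ≡⟨ ∑-cong V (λ y → trans (∑-repr-* y (λ _ → 1)) (∑-cong V (λ a → *-identityʳ (α a)))) ⟩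
      ∑ V (λ _ → u)                             ≡⟨ ∑-vecs-const q d u ⟩
      q ^ d * u                                 ∎
      where open ≡-Reasoning

    -- Both sides count the triples (a, b, y) with a, b ∈ A^d and a·y = b·y.
    ∑-repr² : ∑ pairs (λ (y , z) → repr y z * repr y z) ≡ ∑ V (λ a → α a * ∑ V (λ b → α b * collisions a b))
    ∑-repr² = begin
      ∑ pairs (λ (y , z) → repr y z * repr y z)
        ≡⟨ ∑-pairs _ ⟩
      ∑ V (λ y → ∑ F (λ z → repr y z * repr y z))
        ≡⟨ ∑-cong V (λ y → ∑-repr-* y (repr y)) ⟩
      ∑ V (λ y → ∑ V (λ a → α a * repr y (dot a y)))
        ≡⟨ ∑-swap V V _ ⟩
      ∑ V (λ a → ∑ V (λ y → α a * repr y (dot a y)))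
        ≡⟨ ∑-cong V (λ a → ∑-*ˡ V (α a) _) ⟩
      ∑ V (λ a → α a * ∑ V (λ y → ∑ V (λ b → α b * χ (dot b y ≟ dot a y))))
        ≡⟨ ∑-cong V (λ a → cong (α a *_) (trans (∑-swap V V _) (∑-cong V (λ b → ∑-*ˡ V (α b) _)))) ⟩
      ∑ V (λ a → α a * ∑ V (λ b → α b * collisions a b)) ∎
      where open ≡-Reasoning

    -- The factor `q` is the one `collisions-≤` asks for. For each fixed `a`, the main term q^d sums
    -- to u q^d over `b`, and the diagonal b = a adds at most q^(d+1).
    ∑-repr²-≤ : q * ∑ pairs (λ (y , z) → repr y z * repr y z) ≤ u * (u * q ^ d + q ^ suc d)
    ∑-repr²-≤ = begin
      q * ∑ pairs (λ (y , z) → repr y z * repr y z)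
        ≡⟨ cong (q *_) ∑-repr² ⟩
      q * ∑ V (λ a → α a * ∑ V (λ b → α b * collisions a b))
        ≡⟨ ∑-*ˡ V q _ ⟨
      ∑ V (λ a → q * (α a * ∑ V (λ b → α b * collisions a b)))
        ≡⟨ ∑-cong V (λ a → trans (comm q (α a) _) (cong (α a *_) (trans (sym (∑-*ˡ V q _)) (∑-cong V (λ b → comm q (α b) _))))) ⟩
      ∑ V (λ a → α a * ∑ V (λ b → α b * (q * collisions a b)))
        ≤⟨ ∑-mono V (λ a → *-monoʳ-≤ (α a) (inner a)) ⟩
      ∑ V (λ a → α a * (u * q ^ d + q ^ suc d))
        ≡⟨ ∑-*ʳ V α _ ⟩
      u * (u * q ^ d + q ^ suc d) ∎
      where
      open ≤-Reasoning
      comm : ∀ a b c → a * (b * c) ≡ b * (a * c)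
      comm = solve-∀
      expand : ∀ x p t s → x * (p + t * s) ≡ x * p + t * (x * s)
      expand = solve-∀
      inner : ∀ a → ∑ V (λ b → α b * (q * collisions a b)) ≤ u * q ^ d + q ^ suc d
      inner a = begin
        ∑ V (λ b → α b * (q * collisions a b))
          ≤⟨ ∑-mono V (λ b → *-monoʳ-≤ (α b) (collisions-≤ a b)) ⟩
        ∑ V (λ b → α b * (q ^ d + χ (a ≟ᵥ b) * q ^ suc d))
          ≡⟨ ∑-cong V (λ b → expand (α b) (q ^ d) (χ (a ≟ᵥ b)) (q ^ suc d)) ⟩
        ∑ V (λ b → α b * q ^ d + χ (a ≟ᵥ b) * (α b * q ^ suc d))
          ≡⟨ ∑-distrib-+ V _ _ ⟩
        ∑ V (λ b → α b * q ^ d) + ∑ V (λ b → χ (a ≟ᵥ b) * (α b * q ^ suc d))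
          ≡⟨ cong₂ _+_ (∑-*ʳ V α (q ^ d)) (∑-δ _≟ᵥ_ (vecs-unique q d) (∈-vecs a) (λ b → α b * q ^ suc d)) ⟩
        u * q ^ d + α a * q ^ suc d
          ≤⟨ +-monoʳ-≤ (u * q ^ d) (*-monoˡ-≤ (q ^ suc d) (χ≤1 (all? (_∈? A) a))) ⟩
        u * q ^ d + 1 * q ^ suc d
          ≡⟨ cong (u * q ^ d +_) (*-identityˡ (q ^ suc d)) ⟩
        u * q ^ d + q ^ suc d ∎

    -- Expanding the square gives q² Σ n² - 2 q u Σ n + q^(d+1) u². With Σ n = q^d u, the terms in
    -- u² q^(d+1) cancel against the main term of `∑-repr²-≤`, which leaves u q^(d+2).
    ∑-dev²-≤ : ∑ V (λ y → ∑ F (dev² y)) ≤ u * q ^ (d + 2)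
    -- The cross term 2 q u Σ n is added to both sides in place of a subtraction.
    ∑-dev²-≤ = +-cancelʳ-≤ (2 * (q * (q ^ d * u) * u)) _ _ (begin
      ∑ V (λ y → ∑ F (dev² y)) + 2 * (q * (q ^ d * u) * u)
        ≡⟨ cong₂ _+_ (sym (∑-pairs _)) (cong (λ t → 2 * (q * t * u)) (sym ∑-repr)) ⟩
      ∑ pairs (λ (y , z) → dev² y z) + 2 * (q * ∑ pairs (λ (y , z) → repr y z) * u)
        ≡⟨ cong (∑ pairs (λ (y , z) → dev² y z) +_)
             (sym (trans (∑-*ˡ pairs 2 _) (cong (2 *_) (trans (∑-*ʳ pairs _ u) (cong (_* u) (∑-*ˡ pairs q _)))))) ⟩
      ∑ pairs (λ (y , z) → dev² y z) + ∑ pairs (λ (y , z) → 2 * (q * repr y z * u))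
        ≡⟨ ∑-distrib-+ pairs _ _ ⟨
      ∑ pairs (λ (y , z) → dev² y z + 2 * (q * repr y z * u))
        ≡⟨ ∑-cong pairs (λ (y , z) → ∣m-n∣²+2mn≡m²+n² (q * repr y z) u) ⟩
      ∑ pairs (λ (y , z) → q * repr y z * (q * repr y z) + u * u)
        ≡⟨ ∑-cong pairs (λ (y , z) → regroup q (repr y z) (u * u)) ⟩
      ∑ pairs (λ (y , z) → q * (q * (repr y z * repr y z)) + u * u)
        ≡⟨ ∑-distrib-+ pairs _ _ ⟩
      ∑ pairs (λ (y , z) → q * (q * (repr y z * repr y z))) + ∑ pairs (λ _ → u * u)
        ≡⟨ cong₂ _+_ (trans (∑-*ˡ pairs q _) (cong (q *_) (∑-*ˡ pairs q _)))
             (trans (∑-pairs _) (trans (∑-cong V (λ _ → ∑-allFin-const q (u * u))) (∑-vecs-const q d _))) ⟩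
      q * (q * ∑ pairs (λ (y , z) → repr y z * repr y z)) + q ^ d * (q * (u * u))
        ≤⟨ +-monoˡ-≤ _ (*-monoʳ-≤ q ∑-repr²-≤) ⟩
      q * (u * (u * q ^ d + q * q ^ d)) + q ^ d * (q * (u * u))
        ≡⟨ collect q u (q ^ d) ⟩
      u * (q * (q * q ^ d)) + 2 * (q * (q ^ d * u) * u)
        ≡⟨ cong (λ e → u * q ^ e + 2 * (q * (q ^ d * u) * u)) (+-comm 2 d) ⟩
      u * q ^ (d + 2) + 2 * (q * (q ^ d * u) * u) ∎)
      where
      open ≤-Reasoning
      regroup : ∀ q n s → q * n * (q * n) + s ≡ q * (q * (n * n)) + s
      regroup = solve-∀
      collect : ∀ q u p → q * (u * (u * p + q * p)) + p * (q * (u * u)) ≡ u * (q * (q * p)) + 2 * (q * (p * u) * u)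
      collect = solve-∀

    -- Lower bound from the kernel for an element without a representation

    module _ {x : Fin q} (x≢𝟎 : x ≢ 𝟎)
             (¬repr : (a a′ : Vec (Fin q) d) → All (_∈ A) a → All (_∈ A) a′ → x ≢ dot a a′) where

      -- From a·(a′ k) = x k it would follow that (a·a′) k = x k, and cancelling `k` would represent
      -- `x`.
      repr-kernel≡0 : ∀ {k} → InKernel _⊕_ _·_ k → k ≢ 𝟎 → ∀ {a′} → All (_∈ A) a′ →
                      repr (Vec.map (_· k) a′) (x · k) ≡ 0
      repr-kernel≡0 {k} inK k≢𝟎 {a′} a′∈A = trans (∑-cong V vanish) (trans (∑-const V 0) (*-zeroʳ (length V)))
        where
        vanish : ∀ a → α a * χ (dot a (Vec.map (_· k) a′) ≟ (x · k)) ≡ 0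
        vanish a with all? (_∈? A) a | dot a (Vec.map (_· k) a′) ≟ (x · k)
        ... | no _    | _      = refl
        ... | yes _   | no _   = refl
        ... | yes a∈A | yes eq = contradiction
          (·-cancelʳ k≢𝟎 (trans (sym eq) (dot-kernel inK a a′))) (¬repr a a′ a∈A a′∈A)

      -- The `u` vectors a′ k with a′ ∈ A^d are distinct, and at each of them n vanishes, so the
      -- squared deviation is u².
      fibre-≥ : ∀ {k} → InKernel _⊕_ _·_ k → k ≢ 𝟎 → u * (u * u) ≤ ∑ V (λ y → dev² y (x · k))
      fibre-≥ {k} inK k≢𝟎 = begin
        u * (u * u)                                    ≡⟨ ∑-*ʳ V α (u * u) ⟨
        ∑ V (λ a′ → α a′ * (u * u))                    ≤⟨ ∑-mono V pointwise ⟩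
        ∑ V (λ a′ → dev² (Vec.map (_· k) a′) (x · k))  ≤⟨ ∑-injective _≟ᵥ_ (vecs-unique q d) ∈-vecs
                                                            (Vec.map (_· k)) (map-injective (·-cancelʳ k≢𝟎)) _ ⟩
        ∑ V (λ y → dev² y (x · k))                     ∎
        where
        open ≤-Reasoning
        pointwise : ∀ a′ → α a′ * (u * u) ≤ dev² (Vec.map (_· k) a′) (x · k)
        pointwise a′ with all? (_∈? A) a′
        ... | no _     = z≤n
        ... | yes a′∈A = ≤-reflexive (trans (*-identityˡ (u * u))
          (sym (cong (λ n → ∣ n - u ∣ * ∣ n - u ∣)
            (trans (cong (q *_) (repr-kernel≡0 inK k≢𝟎 a′∈A)) (*-zeroʳ q)))))

      -- Since x ≠ 0, distinct `k` give distinct values x k, so the bounds of `fibre-≥` for the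
      -- nonzero elements of `K` add up.
      ∑-dev²-≥ : (K : Subset q) → (∀ k → k ∈ K → InKernel _⊕_ _·_ k) →
                 (∣ K ∣ ∸ 1) * (u * (u * u)) ≤ ∑ V (λ y → ∑ F (dev² y))
      ∑-dev²-≥ K K-kernel = begin
        (∣ K ∣ ∸ 1) * w              ≡⟨ *-distribʳ-∸ w ∣ K ∣ 1 ⟩
        ∣ K ∣ * w ∸ 1 * w            ≤⟨ m≤n+o⇒m∸n≤o (∣ K ∣ * w) (1 * w) below ⟩
        ∑ F (fibre ∘ (x ·_))         ≤⟨ ∑-injective _≟_ (allFin⁺ q) ∈-allFin (x ·_) (·-cancelˡ x≢𝟎) fibre ⟩
        ∑ F fibre                    ≡⟨ ∑-swap F V _ ⟩
        ∑ V (λ y → ∑ F (dev² y))     ∎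
        where
        open ≤-Reasoning
        w : ℕ
        w = u * (u * u)
        fibre : Fin q → ℕ
        fibre z = ∑ V (λ y → dev² y z)
        -- `fibre-≥` says nothing at k = 0. The delta term pays for that element; it sums to a
        -- single `w` and becomes the - 1 in |K| - 1.
        pointwise : ∀ k → χ (k ∈? K) * w ≤ χ (𝟎 ≟ k) * w + fibre (x · k)
        pointwise k with k ∈? K | 𝟎 ≟ k
        ... | no _    | _       = z≤n
        ... | yes _   | yes _   = m≤m+n (1 * w) _
        ... | yes k∈K | no 𝟎≢k = ≤-trans (≤-reflexive (*-identityˡ w)) (fibre-≥ (K-kernel k k∈K) (𝟎≢k ∘ sym))
        below : ∣ K ∣ * w ≤ 1 * w + ∑ F (fibre ∘ (x ·_))
        below = begin
          ∣ K ∣ * w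
            ≡⟨ cong (_* w) (∑-χ-∈ K) ⟨
          ∑ F (λ k → χ (k ∈? K)) * w
            ≡⟨ ∑-*ʳ F _ w ⟨
          ∑ F (λ k → χ (k ∈? K) * w)
            ≤⟨ ∑-mono F pointwise ⟩
          ∑ F (λ k → χ (𝟎 ≟ k) * w + fibre (x · k))
            ≡⟨ ∑-distrib-+ F _ _ ⟩
          ∑ F (λ k → χ (𝟎 ≟ k) * w) + ∑ F (fibre ∘ (x ·_))
            ≡⟨ cong (_+ ∑ F (fibre ∘ (x ·_))) (trans (∑-δ _≟_ (allFin⁺ q) (∈-allFin 𝟎) (λ _ → w)) (sym (*-identityˡ w))) ⟩
          1 * w + ∑ F (fibre ∘ (x ·_)) ∎

      -- The two estimates of the second moment give u · u² (|K| - 1) ≤ u · q^(d+2), which after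
      -- cancelling `u` contradicts the hypothesis on |A| raised to the power 2d.
      kernel-bound : (K : Subset q) → (∀ k → k ∈ K → InKernel _⊕_ _·_ k) →
                     ¬ (q ^ (d + 2) < (∣ A ∣ ^ (2 * d)) * (∣ K ∣ ∸ 1))
      kernel-bound K K-kernel hyp = conclude u refl
        where
        A²ᵈ≡u² : ∣ A ∣ ^ (2 * d) ≡ u * u
        A²ᵈ≡u² = trans (cong (λ e → ∣ A ∣ ^ (d + e)) (+-identityʳ d))
          (trans (^-distribˡ-+-* ∣ A ∣ d d) (sym (cong₂ _*_ (∑-χ-all A d) (∑-χ-all A d))))
        hyp′ : q ^ (d + 2) < u * u * (∣ K ∣ ∸ 1)
        hyp′ = subst (λ t → q ^ (d + 2) < t * (∣ K ∣ ∸ 1)) A²ᵈ≡u² hyp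
        comm : ∀ κ u → κ * (u * (u * u)) ≡ u * (u * u * κ)
        comm = solve-∀
        estimate : u * (u * u * (∣ K ∣ ∸ 1)) ≤ u * q ^ (d + 2)
        estimate = subst (_≤ u * q ^ (d + 2)) (comm (∣ K ∣ ∸ 1) u) (≤-trans (∑-dev²-≥ K K-kernel) ∑-dev²-≤)
        -- Cancelling `u` requires u ≠ 0. If u = 0, the hypothesis reads q^(d+2) < 0. The variable
        -- `t` stands for `u` so that it can be split into cases.
        conclude : ∀ t → t ≡ u → _
        conclude zero    0≡u = contradiction (subst (λ t → q ^ (d + 2) < t * t * (∣ K ∣ ∸ 1)) (sym 0≡u) hyp′) λ ()
        conclude (suc t) t≡u = <⇒≱ hyp′ (*-cancelˡ-≤ (suc t)
          (subst (λ s → s * (u * u * (∣ K ∣ ∸ 1)) ≤ s * q ^ (d + 2)) (sym t≡u) estimate))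

theorem1p15 : (d q : ℕ) → 1 ≤ d →
    (_⊕_ _·_ : Fin q → Fin q → Fin q) (⊖_ : Fin q → Fin q) (𝟎 𝟏 : Fin q) →
    IsQuasifield q _⊕_ _·_ ⊖_ 𝟎 𝟏 →
    (K : Subset q) → (∀ k → (k ∈ K → InKernel _⊕_ _·_ k) × (InKernel _⊕_ _·_ k → k ∈ K)) →
    (A : Subset q) →
    q ^ (d + 2) < (∣ A ∣ ^ (2 * d)) * (∣ K ∣ ∸ 1) →
    ∀ x → ¬ (x ≡ 𝟎) → InSumProd _⊕_ _·_ 𝟎 d A x
theorem1p15 d q _ _⊕_ _·_ ⊖_ 𝟎 𝟏 Q K isK A hyp x x≢𝟎
  -- A finite search over all pairs of vectors either finds the representation or supplies the
  -- assumption of `kernel-bound`.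
  with anyVec? {q} {d} (λ a → anyVec? {q} {d} (λ a′ →
         all? (_∈? A) a ×-dec all? (_∈? A) a′ ×-dec (x ≟ dot Q a a′)))
... | yes (a , a′ , a∈A , a′∈A , x≡) =
  lookup a , lookup a′ , lookup⁺ a∈A , lookup⁺ a′∈A , trans x≡ (dot≡sumF Q a a′)
... | no ¬∃ = contradiction hyp
  (kernel-bound Q A d x≢𝟎 (λ a a′ a∈A a′∈A x≡ → ¬∃ (a , a′ , a∈A , a′∈A , x≡)) K (λ k → proj₁ (isK k)))
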